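{- There is an absolute constant $C > 0$ such that the following holds. Let $p \in (0,1)$, let $k \ge 1$ be an integer, let $E$ be a finite set, let $\mathcal{D} \subseteq 2^E$ be a nonempty family with $|X| \le k$ for all $X \in \mathcal{D}$, and let $f \colon 2^E \to \mathbb{R}_{\ge 0}$ be a monotone linear or a monotone submodular function. Then for all $\epsilon, \delta \in (0,1)$ there is a query strategy with at most $\left\lceil C \log(1/\min\{\delta,\epsilon\})/(p^2\epsilon) \right\rceil$ rounds that has an approximation factor of \[ \frac{(1-\epsilon)\,p}{1-(1-p)^k} \quad \left( \ge \frac{1-\epsilon}{k} \right) \] with probability at least $1-\delta$.
   Context: Stochastic model: $A \subseteq E$ is a random subset (the active elements) with $e \in A$ with probability $p$ independently for each $e \in E$. $A$ is hidden; querying $e$ reveals whether $e \in A$. A query strategy with $N$ rounds chooses, in each round, a member of $\mathcal{D}$ and queries all its elements, the choice being based only on the answers received in earlier rounds (and possibly randomness independent of $A$). With $Q$ the set of all queried elements, the strategy has an approximation factor of $c$ with probability at least $1-\delta$ if \[ \Pr\left( \max_{X \in \mathcal{D}} f(X \cap A \cap Q) \ge c \max_{Z \in \mathcal{D}} f(Z \cap A) \right) \ge 1-\delta. \] A monotone linear function is $f(X) = \sum_{e \in X} w_e$ with $w_e \ge 0$. -}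

module Defs where

open import Algebra.Bundles using (CommutativeRing)
open import Algebra.Structures using (IsCommutativeRing)
open import Data.Bool.Base using (if_then_else_)
open import Data.Fin.Base using (Fin)
open import Data.Fin.Subset using (Subset; inside; outside; ⊥; _⊆_; _∩_; _∪_)
open import Data.Fin.Subset.Properties using (_∈?_)
open import Data.List.Base as List using (List; []; _∷_; _++_; allFin; filter)
open import Data.List.Membership.Propositional using (_∈_)
open import Data.List.NonEmpty.Base as List⁺ using (List⁺; toList; foldr₁)
open import Data.Nat.Base using (ℕ; zero; suc)
open import Data.Product.Base using (Σ; ∃; _×_; _,_; proj₁; proj₂)
open import Data.Sum.Base using (inj₁; inj₂)
open import Data.Vec.Base as Vec using ()
open import Level using (0ℓ)
open import Relation.Binary.Bundles using (DecTotalOrder)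
open import Relation.Binary.Structures using (IsDecTotalOrder)
open import Relation.Nullary.Decidable.Core using (Dec; yes; no; ⌊_⌋)
open import Relation.Nullary.Negation.Core using (¬_)

record OrderedField : Set₁ where
  infix  4 _≈_ _≤_
  infixl 6 _+_
  infixl 7 _*_
  infix  8 -_
  infix  9 _⁻¹
  field
    Carrier           : Set
    _≈_ _≤_           : Carrier → Carrier → Set
    _+_ _*_           : Carrier → Carrier → Carrier
    -_                : Carrier → Carrier
    0# 1#             : Carrier
    -- total, but 0# ⁻¹ is unconstrained
    _⁻¹               : Carrier → Carrier
    isCommutativeRing : IsCommutativeRing _≈_ _+_ _*_ -_ 0# 1#
    isDecTotalOrder   : IsDecTotalOrder _≈_ _≤_
    0≉1               : ¬ 0# ≈ 1#
    *-inverseʳ        : ∀ x → ¬ x ≈ 0# → x * x ⁻¹ ≈ 1#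
    +-monoʳ-≤         : ∀ x {y z} → y ≤ z → x + y ≤ x + z
    *-nonneg          : ∀ {x y} → 0# ≤ x → 0# ≤ y → 0# ≤ x * y

  commutativeRing : CommutativeRing 0ℓ 0ℓ
  commutativeRing = record { isCommutativeRing = isCommutativeRing }

  decTotalOrder : DecTotalOrder 0ℓ 0ℓ 0ℓ
  decTotalOrder = record { isDecTotalOrder = isDecTotalOrder }

  open IsDecTotalOrder isDecTotalOrder public using (_≤?_)

  fromℕ : ℕ → Carrier
  fromℕ zero    = 0#
  fromℕ (suc n) = 1# + fromℕ n

  IsUpperBound : (Carrier → Set) → Carrier → Set
  IsUpperBound S u = ∀ x → S x → x ≤ u

  IsSupremum : (Carrier → Set) → Carrier → Set
  IsSupremum S s = IsUpperBound S s × (∀ u → IsUpperBound S u → s ≤ u)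

-- The real numbers, axiomatised as the Dedekind-complete ordered field.
-- Classically this determines the structure up to unique isomorphism, and the
-- decidability of the order and `archimedean` add nothing; they are assumed
-- because they do not follow constructively from the remaining axioms.
-- Equality is a setoid equality, so that (with excluded middle) Cauchy
-- sequences of rationals are a model.
record CompleteOrderedField : Set₁ where
  field
    orderedField : OrderedField

  open OrderedField orderedField public

  field
    archimedean : ∀ x → ∃ λ n → x ≤ fromℕ n
    complete    : (S : Carrier → Set) → ∃ S → ∃ (IsUpperBound S) → ∃ (IsSupremum S)

module RealFunctions (ℝ : CompleteOrderedField) where

  open CompleteOrderedField ℝ public
  open CommutativeRing commutativeRing public using (_-_)
  open import Algebra.Properties.Semiring.Exp (CommutativeRing.semiring commutativeRing) public using (_^_)
  open import Algebra.Construct.NaturalChoice.Max (DecTotalOrder.totalOrder decTotalOrder) public using (_⊔_)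
  open import Algebra.Construct.NaturalChoice.Min (DecTotalOrder.totalOrder decTotalOrder) public using (_⊓_)
  open import Relation.Binary.Construct.NonStrictToStrict _≈_ _≤_ public using (_<_)

  infixl 7 _/_
  _/_ : Carrier → Carrier → Carrier
  x / y = x * y ⁻¹

  -- ⌈ x ⌉ is the least natural number n with x ≤ n (so 0 for x ≤ 0), found by
  -- descending from an upper bound.
  descend : Carrier → ℕ → ℕ
  descend x zero    = zero
  descend x (suc n) = if ⌊ x ≤? fromℕ n ⌋ then descend x n else suc n

  ⌈_⌉ : Carrier → ℕ
  ⌈ x ⌉ = descend x (proj₁ (archimedean x))

  ∑ : {I : Set} → List I → (I → Carrier) → Carrier
  ∑ is g = List.foldr _+_ 0# (List.map g is)

  -- a = x₀ ≤ x₁ ≤ … ≤ xₘ = b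
  data Partition : Carrier → Carrier → Set where
    end  : ∀ {b} → Partition b b
    step : ∀ {a b} x → a ≤ x → Partition x b → Partition a b

  -- The lower Darboux sum of t ↦ 1/t for a partition of [a,b], a > 0: the
  -- infimum of 1/t over [xᵢ,xᵢ₊₁] is 1/xᵢ₊₁.
  lowerSum : ∀ {a b} → Partition a b → Carrier
  lowerSum end                  = 0#
  lowerSum (step {a = a} x _ π) = (x - a) / x + lowerSum π

  LowerSums : Carrier → Carrier → Set
  LowerSums y s = Σ (Partition 1# y) λ π → s ≈ lowerSum π

  module R = CommutativeRing commutativeRing
  module O = DecTotalOrder decTotalOrder

  +-monoˡ-≤ : ∀ z {x y} → x ≤ y → x + z ≤ y + z
  +-monoˡ-≤ z {x} {y} x≤y = O.≤-respˡ-≈ (R.+-comm z x) (O.≤-respʳ-≈ (R.+-comm z y) (+-monoʳ-≤ z x≤y))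

  a+[x-a]≈x : ∀ a x → a + (x - a) ≈ x
  a+[x-a]≈x a x = R.trans (R.+-comm a (x - a)) (R.trans (R.+-assoc x (- a) a)
    (R.trans (R.+-congˡ (R.-‿inverseˡ a)) (R.+-identityʳ x)))

  x≤y⇒0≤y-x : ∀ {x y} → x ≤ y → 0# ≤ y - x
  x≤y⇒0≤y-x {x} x≤y = O.≤-respˡ-≈ (R.-‿inverseʳ x) (+-monoˡ-≤ (- x) x≤y)

  0≤y-x⇒x≤y : ∀ {x y} → 0# ≤ y - x → x ≤ y
  0≤y-x⇒x≤y {x} {y} p = O.≤-respˡ-≈ (R.+-identityʳ x) (O.≤-respʳ-≈ (a+[x-a]≈x x y) (+-monoʳ-≤ x p))

  *-monoˡ-≤ : ∀ {z x y} → 0# ≤ z → x ≤ y → z * x ≤ z * y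
  *-monoˡ-≤ {z} {x} {y} 0≤z x≤y = 0≤y-x⇒x≤y (O.≤-respʳ-≈
    (R.trans (R.distribˡ z y (- x)) (R.+-congˡ (R.sym (-‿distribʳ-* z x))))
    (*-nonneg 0≤z (x≤y⇒0≤y-x x≤y)))
    where open import Algebra.Properties.Ring R.ring using (-‿distribʳ-*)

  0≤1 : 0# ≤ 1#
  0≤1 with O.total 0# 1#
  ... | inj₁ p = p
  ... | inj₂ p = O.≤-respʳ-≈ -1*-1≈1 (*-nonneg 0≤-1 0≤-1)
    where
    open import Algebra.Properties.Ring R.ring using (-1*x≈-x; -‿involutive)
    0≤-1 : 0# ≤ - 1#
    0≤-1 = O.≤-respʳ-≈ (R.+-identityˡ (- 1#)) (x≤y⇒0≤y-x p)
    -1*-1≈1 : - 1# * - 1# ≈ 1#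
    -1*-1≈1 = R.trans (-1*x≈-x (- 1#)) (-‿involutive 1#)

  1≤x⇒x≉0 : ∀ {x} → 1# ≤ x → ¬ x ≈ 0#
  1≤x⇒x≉0 1≤x x≈0 = 0≉1 (O.antisym 0≤1 (O.≤-respʳ-≈ x≈0 1≤x))

  1≤x⇒x⁻¹≤1 : ∀ {x} → 1# ≤ x → x ⁻¹ ≤ 1#
  1≤x⇒x⁻¹≤1 {x} 1≤x with O.total (x ⁻¹) 1#
  ... | inj₁ p = p
  ... | inj₂ p = O.reflexive (R.trans (R.sym (R.*-identityˡ _)) (R.trans (R.*-congʳ 1≈x) x*x⁻¹≈1))
    where
    x*x⁻¹≈1 : x * x ⁻¹ ≈ 1#
    x*x⁻¹≈1 = *-inverseʳ x (1≤x⇒x≉0 1≤x)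
    1≈x : 1# ≈ x
    1≈x = O.antisym 1≤x (O.≤-respˡ-≈ (R.*-identityʳ x) (O.≤-respʳ-≈ x*x⁻¹≈1
      (*-monoˡ-≤ (O.trans 0≤1 1≤x) p)))

  a+lowerSum≤b : ∀ {a b} (π : Partition a b) → 1# ≤ a → a + lowerSum π ≤ b
  a+lowerSum≤b end _ = O.reflexive (R.+-identityʳ _)
  a+lowerSum≤b (step {a = a} x a≤x π) 1≤a =
    O.trans (+-monoʳ-≤ a (+-monoˡ-≤ (lowerSum π) summand≤))
      (O.trans (O.reflexive (R.trans (R.sym (R.+-assoc a (x - a) _)) (R.+-congʳ (a+[x-a]≈x a x))))
        (a+lowerSum≤b π 1≤x))
    where
    1≤x : 1# ≤ x
    1≤x = O.trans 1≤a a≤x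
    summand≤ : (x - a) / x ≤ x - a
    summand≤ = O.≤-respʳ-≈ (R.*-identityʳ _) (*-monoˡ-≤ (x≤y⇒0≤y-x a≤x) (1≤x⇒x⁻¹≤1 1≤x))

  lowerSums-bounded : ∀ y → IsUpperBound (LowerSums y) y
  lowerSums-bounded y s (π , s≈) = O.trans (O.reflexive s≈)
    (O.trans (O.≤-respˡ-≈ (R.+-identityˡ _) (+-monoˡ-≤ (lowerSum π) 0≤1))
      (a+lowerSum≤b π O.refl))

  -- ∫₁ʸ dt/t as a lower Darboux integral
  ∫₁dt/t : ∀ y → 1# ≤ y → ∃ (IsSupremum (LowerSums y))
  ∫₁dt/t y 1≤y = complete (LowerSums y) (_ , step y 1≤y end , R.refl) (y , lowerSums-bounded y)

  -- The natural logarithm on the positive reals, with log y = - log (1/y) for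
  -- 0 < y < 1; its values elsewhere carry no meaning.
  log : Carrier → Carrier
  log y with 1# ≤? y | 1# ≤? y ⁻¹
  ... | yes 1≤y | _         = proj₁ (∫₁dt/t y 1≤y)
  ... | no _    | yes 1≤y⁻¹ = - proj₁ (∫₁dt/t (y ⁻¹) 1≤y⁻¹)
  ... | no _    | no _      = 0#

-- The finite ground set E is Fin n.
module StochasticQueries (ℝ : CompleteOrderedField) where

  open RealFunctions ℝ

  NonNegative : ∀ {n} → (Subset n → Carrier) → Set
  NonNegative f = ∀ X → 0# ≤ f X

  Monotone : ∀ {n} → (Subset n → Carrier) → Set
  Monotone f = ∀ X Y → X ⊆ Y → f X ≤ f Y

  Submodular : ∀ {n} → (Subset n → Carrier) → Set
  Submodular f = ∀ X Y → f (X ∪ Y) + f (X ∩ Y) ≤ f X + f Y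

  MonotoneSubmodular : ∀ {n} → (Subset n → Carrier) → Set
  MonotoneSubmodular f = Monotone f × Submodular f

  MonotoneLinear : ∀ {n} → (Subset n → Carrier) → Set
  MonotoneLinear {n} f = Σ (Fin n → Carrier) λ w →
    (∀ e → 0# ≤ w e) × (∀ X → f X ≈ ∑ (filter (_∈? X) (allFin n)) w)

  -- A deterministic adaptive strategy as a decision tree: after querying X the
  -- strategy learns X ∩ A and continues with the subtree chosen by it.
  data DecisionTree {n} (D : List⁺ (Subset n)) : ℕ → Set where
    stop  : DecisionTree D zero
    query : ∀ {N} X → X ∈ toList D → (Subset n → DecisionTree D N) → DecisionTree D (suc N)

  queried : ∀ {n} {D : List⁺ (Subset n)} {N} → DecisionTree D N → Subset n → Subset n
  queried stop             A = ⊥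
  queried (query X _ next) A = X ∪ queried (next (X ∩ A)) A

  -- A strategy may use randomness independent of A: a seed is drawn from a
  -- finite distribution before the first round.  As there are finitely many
  -- decision trees with N rounds up to behaviour, finite seed spaces cover all
  -- randomised strategies.
  record QueryStrategy {n} (D : List⁺ (Subset n)) (N : ℕ) : Set where
    field
      seeds   : ℕ
      prob    : Fin seeds → Carrier
      prob≥0  : ∀ ω → 0# ≤ prob ω
      ∑prob≈1 : ∑ (allFin seeds) prob ≈ 1#
      tree    : Fin seeds → DecisionTree D N

  allSubsets : ∀ n → List (Subset n)
  allSubsets zero    = Vec.[] ∷ []
  allSubsets (suc n) = List.map (inside Vec.∷_) (allSubsets n) ++ List.map (outside Vec.∷_) (allSubsets n)

  -- the probability that A is the set of active elements
  mass : Carrier → ∀ {n} → Subset n → Carrier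
  mass p Vec.[]            = 1#
  mass p (inside  Vec.∷ A) = p * mass p A
  mass p (outside Vec.∷ A) = (1# - p) * mass p A

  𝟙 : {P : Set} → Dec P → Carrier
  𝟙 P? = if ⌊ P? ⌋ then 1# else 0#

  Pr : Carrier → ∀ {n} {D : List⁺ (Subset n)} {N} (σ : QueryStrategy D N) →
       let open QueryStrategy σ in
       {P : Fin seeds → Subset n → Set} → (∀ ω A → Dec (P ω A)) → Carrier
  Pr p {n} σ P? = ∑ (allFin seeds) λ ω → ∑ (allSubsets n) λ A → (prob ω * mass p A) * 𝟙 (P? ω A)
    where open QueryStrategy σ

  max : {I : Set} → List⁺ I → (I → Carrier) → Carrier
  max is g = foldr₁ _⊔_ (List⁺.map g is)

  -- σ has an approximation factor of c with probability at least 1 - δ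
  HasApproximationFactor : Carrier → ∀ {n} → (Subset n → Carrier) → {D : List⁺ (Subset n)} {N : ℕ} →
                           QueryStrategy D N → (c δ : Carrier) → Set
  HasApproximationFactor p f {D} σ c δ =
    1# - δ ≤ Pr p σ (λ ω A → c * max D (λ Z → f (Z ∩ A))
                               ≤? max D (λ X → f ((X ∩ A) ∩ queried (tree ω) A)))
    where open QueryStrategy σ

{-# OPTIONS --safe #-}

-- Query greedily and optimistically: having learnt the active elements K of the queried set Q, query the
-- X ∈ D that maximises f when all unqueried elements are assumed active.  Its value U under this
-- assumption bounds the hidden optimum.  Let K₀ be the known active part of X and N its unqueried part.
-- Submodularity gives 𝔼 f (K₀ ∪ (N ∩ A)) ≥ (1 - p) f K₀ + p U, while with probability at least
-- (1 - p)ᵏ no element of N is active and the value is only f K₀.  Hence, with c the claimed factor, a reverse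
-- Markov inequality shows that a round fails to reach c U with probability at most 1 - εp, given the past.
-- After M rounds the failure probability is at most (1 - εp)ᴹ, and this is at most δ as soon as
-- M εp ≥ log (1/δ); so C = 1 suffices.
module Submission where

open import Algebra.Bundles using (CommutativeRing)
open import Algebra.Properties.IdempotentCommutativeMonoid using (∙-distrˡ-∙)
open import Algebra.Solver.Ring.AlmostCommutativeRing using (fromCommutativeRing; _-Raw-AlmostCommutative⟶_)
open import Data.Bool.Base using (Bool; true; false; if_then_else_; _∧_; _∨_)
open import Data.Fin.Base using (Fin; zero; suc)
open import Data.Fin.Subset using (Subset; inside; outside; ⊥; ⊤; ∁; ∣_∣; _⊆_; _∩_; _∪_)
open import Data.Fin.Subset.Properties using (_∈?_; ∈⊤; p∩q⊆p; p⊆p∪q; q⊆p∪q; x∈p∪q⁻; x∈p∪q⁺; x∈p∩q⁺; x∈p∩q⁻; ∪-assoc; ∪-identityˡ; ∪-identityʳ; ∩-identityʳ; ∩-zeroˡ; ∪-distribˡ-∩; ∪-idempotentCommutativeMonoid; ∣p∩q∣≤∣p∣)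
open import Data.Integer.Base as ℤ using (ℤ; +_; -[1+_]; _⊖_; _◃_)
import Data.Integer.Properties as ℤ
open import Data.List.Base as List using (List; []; _∷_; _++_; allFin; filter)
open import Data.List.Membership.Propositional using (_∈_)
open import Data.List.NonEmpty.Base using (List⁺; _∷_; toList)
open import Data.List.Properties using (map-∘)
open import Data.List.Relation.Unary.Any using (here; there)
open import Data.Maybe.Base as Maybe using (Maybe)
open import Data.Nat.Base as ℕ using (ℕ; zero; suc)
import Data.Nat.Properties as ℕ
open import Data.Product.Base using (Σ; ∃; _×_; _,_; proj₁; proj₂)
open import Data.Sign.Base as Sign using ()
open import Data.Sum.Base as Sum using (_⊎_; inj₁; inj₂; [_,_]′)
open import Data.Vec.Base using ([]; _∷_; lookup)
open import Data.Vec.Properties using (lookup-zipWith; []=⇒lookup; lookup⇒[]=)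
open import Function.Base using (_∘_; id)
open import Relation.Binary.PropositionalEquality as ≡ using (_≡_; cong; cong₂)
open import Relation.Nullary.Decidable.Core using (Dec; yes; no; does; dec⇒maybe)
open import Relation.Nullary.Negation.Core using (¬_; contradiction)
open import Defs

-- Normalisation of ring expressions with integer coefficients.

module IntegerCoefficientSolver {c ℓ} (CR : CommutativeRing c ℓ) where
  open CommutativeRing CR hiding (zero)
  open import Algebra.Properties.Ring ring using (-‿distribˡ-*; -‿distribʳ-*; -‿involutive; -0#≈0#; -‿+-comm)
  open import Algebra.Properties.Semiring.Mult.TCOptimised semiring using (1+×; ×-homo-+; ×1-homo-*) renaming (_×_ to _⋆_)
  open import Relation.Binary.Reasoning.Setoid setoid

  -- Constants of an abstract ring do not compute, so coefficients are taken from the integers. The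
  -- optimised multiple makes `⟦ + 1 ⟧` reduce to `1#`, which lets `con (+ 1)` stand for `1#` in
  -- goals.
  ⟦_⟧ : ℤ → Carrier
  ⟦ + n ⟧      = n ⋆ 1#
  ⟦ -[1+ n ] ⟧ = - (suc n ⋆ 1#)

  ⊖-homo : ∀ m n → ⟦ m ⊖ n ⟧ ≈ m ⋆ 1# - n ⋆ 1#
  ⊖-homo zero    zero    = sym (-‿inverseʳ 0#)
  ⊖-homo (suc m) zero    = sym (trans (+-congˡ -0#≈0#) (+-identityʳ _))
  ⊖-homo zero    (suc n) = sym (+-identityˡ _)
  ⊖-homo (suc m) (suc n) = begin
    ⟦ suc m ⊖ suc n ⟧                       ≡⟨ cong ⟦_⟧ (ℤ.[1+m]⊖[1+n]≡m⊖n m n) ⟩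
    ⟦ m ⊖ n ⟧                               ≈⟨ ⊖-homo m n ⟩
    a - b                                   ≈⟨ +-congʳ (+-identityʳ a) ⟨
    a + 0# - b                              ≈⟨ +-congʳ (+-congˡ (-‿inverseʳ 1#)) ⟨
    a + (1# - 1#) - b                       ≈⟨ +-congʳ (+-assoc a 1# (- 1#)) ⟨
    a + 1# - 1# - b                         ≈⟨ +-assoc _ (- 1#) (- b) ⟩
    a + 1# + (- 1# - b)                     ≈⟨ +-cong (+-comm a 1#) (-‿+-comm 1# b) ⟩
    1# + a - (1# + b)                       ≈⟨ +-cong (1+× m 1#) (-‿cong (1+× n 1#)) ⟨
    suc m ⋆ 1# - suc n ⋆ 1#                 ∎
    where
    a = m ⋆ 1#
    b = n ⋆ 1#

  +-homo : ∀ i j → ⟦ i ℤ.+ j ⟧ ≈ ⟦ i ⟧ + ⟦ j ⟧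
  +-homo (+ m)      (+ n)      = ×-homo-+ 1# m n
  +-homo (+ m)      -[1+ n ]   = ⊖-homo m (suc n)
  +-homo -[1+ m ]   (+ n)      = trans (⊖-homo n (suc m)) (+-comm _ _)
  +-homo -[1+ m ]   -[1+ n ]   = begin
    - (suc (suc (m ℕ.+ n)) ⋆ 1#)       ≡⟨ cong (λ k → - (suc k ⋆ 1#)) (ℕ.+-suc m n) ⟨
    - ((suc m ℕ.+ suc n) ⋆ 1#)         ≈⟨ -‿cong (×-homo-+ 1# (suc m) (suc n)) ⟩
    - (suc m ⋆ 1# + suc n ⋆ 1#)        ≈⟨ -‿+-comm _ _ ⟨
    - (suc m ⋆ 1#) - suc n ⋆ 1#        ∎

  -◃-homo : ∀ n → ⟦ Sign.- ◃ n ⟧ ≈ - (n ⋆ 1#)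
  -◃-homo zero    = sym -0#≈0#
  -◃-homo (suc n) = refl

  +◃-homo : ∀ n → ⟦ Sign.+ ◃ n ⟧ ≈ n ⋆ 1#
  +◃-homo zero    = refl
  +◃-homo (suc n) = refl

  *-homo : ∀ i j → ⟦ i ℤ.* j ⟧ ≈ ⟦ i ⟧ * ⟦ j ⟧
  *-homo (+ m)      (+ n)      = trans (+◃-homo (m ℕ.* n)) (×1-homo-* m n)
  *-homo (+ m)      -[1+ n ]   = trans (-◃-homo (m ℕ.* suc n)) (trans (-‿cong (×1-homo-* m (suc n))) (-‿distribʳ-* _ _))
  *-homo -[1+ m ]   (+ n)      = trans (-◃-homo (suc m ℕ.* n)) (trans (-‿cong (×1-homo-* (suc m) n)) (-‿distribˡ-* _ _))
  *-homo -[1+ m ]   -[1+ n ]   = begin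
    (suc m ℕ.* suc n) ⋆ 1#           ≈⟨ ×1-homo-* (suc m) (suc n) ⟩
    a * b                            ≈⟨ -‿involutive _ ⟨
    - - (a * b)                      ≈⟨ -‿cong (-‿distribʳ-* a b) ⟩
    - (a * - b)                      ≈⟨ -‿distribˡ-* a (- b) ⟩
    - a * - b                        ∎
    where
    a = suc m ⋆ 1#
    b = suc n ⋆ 1#

  -‿homo : ∀ i → ⟦ ℤ.- i ⟧ ≈ - ⟦ i ⟧
  -‿homo (+ zero)    = sym -0#≈0#
  -‿homo (+ (suc n)) = refl
  -‿homo -[1+ n ]    = sym (-‿involutive _)

  morphism : ℤ.+-*-rawRing -Raw-AlmostCommutative⟶ fromCommutativeRing CR
  morphism = record
    { ⟦_⟧    = ⟦_⟧
    ; +-homo = +-homo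
    ; *-homo = *-homo
    ; -‿homo = -‿homo
    ; 0-homo = refl
    ; 1-homo = refl
    }

  _coeff≟_ : ∀ i j → Maybe (⟦ i ⟧ ≈ ⟦ j ⟧)
  i coeff≟ j = Maybe.map (λ i≡j → reflexive (cong ⟦_⟧ i≡j)) (dec⇒maybe (i ℤ.≟ j))

  open import Algebra.Solver.Ring ℤ.+-*-rawRing (fromCommutativeRing CR) morphism _coeff≟_ public
    using (solve; con; _:+_; _:*_; _:-_; _:=_)

-- Inequalities in an ordered field, finite maxima and sums, and the logarithm.

module RealLemmas (ℝ : CompleteOrderedField) where
  open RealFunctions ℝ
  open StochasticQueries ℝ using (max; 𝟙)
  open IntegerCoefficientSolver commutativeRing public using (solve; con; _:+_; _:*_; _:-_; _:=_)
  open import Algebra.Construct.NaturalChoice.Max O.totalOrder using (x≤x⊔y; x≤y⊔x; ⊔-lub; ⊔-mono-≤)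
  open import Relation.Binary.Reasoning.Setoid R.setoid

  ≤-by : ∀ {x y d} → 0# ≤ d → x + d ≈ y → x ≤ y
  ≤-by {x} 0≤d x+d≈y = O.≤-respˡ-≈ (R.+-identityʳ x) (O.≤-respʳ-≈ x+d≈y (+-monoʳ-≤ x 0≤d))

  +-nonneg : ∀ {x y} → 0# ≤ x → 0# ≤ y → 0# ≤ x + y
  +-nonneg 0≤x 0≤y = O.trans 0≤x (≤-by 0≤y R.refl)

  +-mono-≤ : ∀ {x y u v} → x ≤ y → u ≤ v → x + u ≤ y + v
  +-mono-≤ {y = y} {u} x≤y u≤v = O.trans (+-monoˡ-≤ u x≤y) (+-monoʳ-≤ y u≤v)

  *-monoʳ-≤ : ∀ {z x y} → 0# ≤ z → x ≤ y → x * z ≤ y * z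
  *-monoʳ-≤ 0≤z x≤y = O.≤-respˡ-≈ (R.*-comm _ _) (O.≤-respʳ-≈ (R.*-comm _ _) (*-monoˡ-≤ 0≤z x≤y))

  ≰⇒> : ∀ {x y} → ¬ x ≤ y → y < x
  ≰⇒> {x} {y} x≰y with O.total x y
  ... | inj₁ x≤y = contradiction x≤y x≰y
  ... | inj₂ y≤x = y≤x , λ y≈x → x≰y (O.reflexive (R.sym y≈x))

  <⇒≱ : ∀ {x y} → x < y → ¬ y ≤ x
  <⇒≱ (x≤y , x≉y) y≤x = x≉y (O.antisym x≤y y≤x)

  ≤-<-trans : ∀ {x y z} → x ≤ y → y < z → x < z
  ≤-<-trans x≤y y<z = O.trans x≤y (proj₁ y<z) , λ x≈z → <⇒≱ y<z (O.≤-respˡ-≈ x≈z x≤y)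

  <-≤-trans : ∀ {x y z} → x < y → y ≤ z → x < z
  <-≤-trans x<y y≤z = O.trans (proj₁ x<y) y≤z , λ x≈z → <⇒≱ x<y (O.≤-respʳ-≈ (R.sym x≈z) y≤z)

  0<⇒≉0 : ∀ {x} → 0# < x → ¬ x ≈ 0#
  0<⇒≉0 (_ , 0≉x) x≈0 = 0≉x (R.sym x≈0)

  0<x⇒0≤x⁻¹ : ∀ {x} → 0# < x → 0# ≤ x ⁻¹
  0<x⇒0≤x⁻¹ {x} 0<x with O.total 0# (x ⁻¹)
  ... | inj₁ 0≤x⁻¹ = 0≤x⁻¹
  ... | inj₂ x⁻¹≤0 = contradiction (O.antisym 0≤1 1≤0) 0≉1
    where
    1≤0 : 1# ≤ 0#
    1≤0 = O.≤-respˡ-≈ (*-inverseʳ x (0<⇒≉0 0<x)) (O.≤-respʳ-≈ (R.zeroʳ x) (*-monoˡ-≤ (proj₁ 0<x) x⁻¹≤0))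

  x/y*y≈x : ∀ x {y} → 0# < y → (x / y) * y ≈ x
  x/y*y≈x x {y} 0<y = begin
    x * y ⁻¹ * y    ≈⟨ solve 3 (λ a b c → a :* b :* c := a :* (c :* b)) R.refl x (y ⁻¹) y ⟩
    x * (y * y ⁻¹)  ≈⟨ R.*-congˡ (*-inverseʳ y (0<⇒≉0 0<y)) ⟩
    x * 1#          ≈⟨ R.*-identityʳ x ⟩
    x               ∎

  *-cancelʳ-≤ : ∀ {x y z} → 0# < z → x * z ≤ y * z → x ≤ y
  *-cancelʳ-≤ {x} {y} {z} 0<z xz≤yz =
    O.≤-respˡ-≈ (cancel x) (O.≤-respʳ-≈ (cancel y) (*-monoʳ-≤ (0<x⇒0≤x⁻¹ 0<z) xz≤yz))
    where
    cancel : ∀ a → a * z * z ⁻¹ ≈ a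
    cancel a = R.trans (R.*-assoc a z _) (R.trans (R.*-congˡ (*-inverseʳ z (0<⇒≉0 0<z))) (R.*-identityʳ a))

  *-pos : ∀ {x y} → 0# < x → 0# < y → 0# < x * y
  *-pos {x} {y} 0<x 0<y = *-nonneg (proj₁ 0<x) (proj₁ 0<y) , λ 0≈xy →
    <⇒≱ 0<x (*-cancelʳ-≤ 0<y (O.reflexive (R.trans (R.sym 0≈xy) (R.sym (R.zeroˡ y)))))

  x<y⇒0<y-x : ∀ {x y} → x < y → 0# < y - x
  x<y⇒0<y-x {x} {y} x<y = x≤y⇒0≤y-x (proj₁ x<y) , λ 0≈y-x → proj₂ x<y (begin
    x            ≈⟨ R.+-identityʳ x ⟨
    x + 0#       ≈⟨ R.+-congˡ 0≈y-x ⟩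
    x + (y - x)  ≈⟨ a+[x-a]≈x x y ⟩
    y            ∎)

  1-x≤1 : ∀ {x} → 0# ≤ x → 1# - x ≤ 1#
  1-x≤1 {x} 0≤x = ≤-by 0≤x (solve 1 (λ x → con (+ 1) :- x :+ x := con (+ 1)) R.refl x)

  ^-nonneg : ∀ {x} → 0# ≤ x → ∀ n → 0# ≤ x ^ n
  ^-nonneg 0≤x zero    = 0≤1
  ^-nonneg 0≤x (suc n) = *-nonneg 0≤x (^-nonneg 0≤x n)

  ^-antimono : ∀ {x} → 0# ≤ x → x ≤ 1# → ∀ {m n} → m ℕ.≤ n → x ^ n ≤ x ^ m
  ^-antimono 0≤x x≤1 {n = zero}  ℕ.z≤n       = O.refl
  ^-antimono 0≤x x≤1 {n = suc n} ℕ.z≤n       = O.trans (*-monoˡ-≤ 0≤x (^-antimono 0≤x x≤1 {n = n} ℕ.z≤n))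
    (O.trans (O.reflexive (R.*-identityʳ _)) x≤1)
  ^-antimono 0≤x x≤1             (ℕ.s≤s m≤n) = *-monoˡ-≤ 0≤x (^-antimono 0≤x x≤1 m≤n)

  ^-inverse : ∀ {x y} → x * y ≈ 1# → ∀ n → x ^ n * y ^ n ≈ 1#
  ^-inverse         xy≈1 zero    = R.*-identityˡ 1#
  ^-inverse {x} {y} xy≈1 (suc n) = begin
    x * x ^ n * (y * y ^ n)    ≈⟨ solve 4 (λ a b c d → a :* b :* (c :* d) := a :* c :* (b :* d)) R.refl x (x ^ n) y (y ^ n) ⟩
    x * y * (x ^ n * y ^ n)    ≈⟨ R.*-cong xy≈1 (^-inverse xy≈1 n) ⟩
    1# * 1#                    ≈⟨ R.*-identityˡ 1# ⟩
    1#                         ∎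

  fromℕ-nonneg : ∀ n → 0# ≤ fromℕ n
  fromℕ-nonneg zero    = O.refl
  fromℕ-nonneg (suc n) = +-nonneg 0≤1 (fromℕ-nonneg n)

  -- Passing from `k` to `suc k` adds `p * (1# - p) ^ k`, which is at most `p`. This is the source
  -- of the lower bound `(1# - ε) / fromℕ k` for the factor.
  bernoulli : ∀ {p} → 0# ≤ p → p ≤ 1# → ∀ k → 1# - (1# - p) ^ k ≤ fromℕ k * p
  bernoulli {p} 0≤p p≤1 zero    = O.reflexive (solve 1 (λ p → con (+ 1) :- con (+ 1) := con (+ 0) :* p) R.refl p)
  bernoulli {p} 0≤p p≤1 (suc k) = O.trans
    (≤-by (*-nonneg 0≤p 0≤1-s)
      (solve 2 (λ p s → con (+ 1) :- (con (+ 1) :- p) :* s :+ p :* (con (+ 1) :- s) := con (+ 1) :- s :+ p) R.refl p s))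
    (O.trans (+-monoˡ-≤ p (bernoulli 0≤p p≤1 k))
      (O.reflexive (solve 2 (λ p k → k :* p :+ p := (con (+ 1) :+ k) :* p) R.refl p (fromℕ k))))
    where
    s = (1# - p) ^ k
    0≤1-s : 0# ≤ 1# - s
    0≤1-s = x≤y⇒0≤y-x (^-antimono (x≤y⇒0≤y-x p≤1) (1-x≤1 0≤p) {n = k} ℕ.z≤n)

  x≤⌈x⌉ : ∀ x → x ≤ fromℕ ⌈ x ⌉
  x≤⌈x⌉ x = descend-≤ (proj₁ (archimedean x)) (proj₂ (archimedean x))
    where
    descend-≤ : ∀ n → x ≤ fromℕ n → x ≤ fromℕ (descend x n)
    descend-≤ zero    x≤n = x≤n
    descend-≤ (suc n) x≤1+n with x ≤? fromℕ n
    ... | yes x≤n = descend-≤ n x≤n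
    ... | no  _   = x≤1+n

  0≤𝟙 : {P : Set} (P? : Dec P) → 0# ≤ 𝟙 P?
  0≤𝟙 (yes _) = 0≤1
  0≤𝟙 (no _)  = O.refl

  1≤𝟙 : {P : Set} (P? : Dec P) → P → 1# ≤ 𝟙 P?
  1≤𝟙 (yes _) _ = O.refl
  1≤𝟙 (no ¬p) p = contradiction p ¬p

  g≤max : {I : Set} (is : List⁺ I) (g : I → Carrier) → ∀ {i} → i ∈ toList is → g i ≤ max is g
  g≤max (i ∷ [])     g (here ≡.refl) = O.refl
  g≤max (i ∷ j ∷ js) g (here ≡.refl) = x≤x⊔y _ _
  g≤max (i ∷ j ∷ js) g (there i∈)    = O.trans (g≤max (j ∷ js) g i∈) (x≤y⊔x _ _)

  max-mono : {I : Set} (is : List⁺ I) {g h : I → Carrier} → (∀ i → g i ≤ h i) → max is g ≤ max is h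
  max-mono (i ∷ is) {g} {h} g≤h = go i is
    where
    go : ∀ i is → max (i ∷ is) g ≤ max (i ∷ is) h
    go i []       = g≤h i
    go i (j ∷ js) = ⊔-mono-≤ (g≤h i) (go j js)

  argmax : {I : Set} (is : List⁺ I) (g : I → Carrier) → ∃ λ i → i ∈ toList is × max is g ≤ g i
  argmax (i ∷ is) g = go i is
    where
    go : ∀ i is → ∃ λ l → l ∈ (i ∷ is) × max (i ∷ is) g ≤ g l
    go i []       = i , here ≡.refl , O.refl
    go i (j ∷ js) with go j js | O.total (g i) (max (j ∷ js) g)
    ... | l , l∈ , m≤gl | inj₁ gi≤m = l , there l∈ , ⊔-lub (O.trans gi≤m m≤gl) m≤gl
    ... | _             | inj₂ m≤gi = i , here ≡.refl , ⊔-lub O.refl m≤gi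

  ∑-cong : {I : Set} (is : List I) {g h : I → Carrier} → (∀ i → g i ≈ h i) → ∑ is g ≈ ∑ is h
  ∑-cong []       g≈h = R.refl
  ∑-cong (i ∷ is) g≈h = R.+-cong (g≈h i) (∑-cong is g≈h)

  ∑-++ : {I : Set} (is js : List I) (g : I → Carrier) → ∑ (is ++ js) g ≈ ∑ is g + ∑ js g
  ∑-++ []       js g = R.sym (R.+-identityˡ _)
  ∑-++ (i ∷ is) js g = R.trans (R.+-congˡ (∑-++ is js g)) (R.sym (R.+-assoc _ _ _))

  ∑-map : {I J : Set} (φ : I → J) (is : List I) (g : J → Carrier) → ∑ (List.map φ is) g ≡ ∑ is (g ∘ φ)
  ∑-map φ is g = cong (List.foldr _+_ 0#) (≡.sym (map-∘ is))

  ∑-+ : {I : Set} (is : List I) (g h : I → Carrier) → ∑ is (λ i → g i + h i) ≈ ∑ is g + ∑ is h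
  ∑-+ []       g h = R.sym (R.+-identityʳ 0#)
  ∑-+ (i ∷ is) g h = R.trans (R.+-congˡ (∑-+ is g h))
    (solve 4 (λ a b c d → (a :+ b) :+ (c :+ d) := (a :+ c) :+ (b :+ d)) R.refl _ _ _ _)

  ∑-mono : {I : Set} (is : List I) {g h : I → Carrier} → (∀ i → g i ≤ h i) → ∑ is g ≤ ∑ is h
  ∑-mono []       g≤h = O.refl
  ∑-mono (i ∷ is) g≤h = +-mono-≤ (g≤h i) (∑-mono is g≤h)

  log-isSupremum : ∀ {y} → 1# ≤ y → IsSupremum (LowerSums y) (log y)
  log-isSupremum {y} 1≤y with 1# ≤? y | 1# ≤? y ⁻¹
  ... | yes 1≤y′ | _ = proj₂ (∫₁dt/t y 1≤y′)
  ... | no 1≰y   | _ = contradiction 1≤y 1≰y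

  -- On the partition a, ab, ab², … with b = 1/(1 - x), every cell contributes exactly x to the lower sum.
  geometricPartition : ∀ {x b y} → 1# ≤ b → (1# - x) * b ≈ 1# → ∀ j a → 0# < a → a * b ^ j ≤ y →
                       Σ (Partition a y) λ π → fromℕ j * x + (y - a * b ^ j) / y ≤ lowerSum π
  geometricPartition {x} {b} {y} 1≤b rb≈1 zero a 0<a a≤y =
    -- A last cell from `a` to `y` completes the partition. Its contribution stays in the bound
    -- because `log≤⇒*^≤1` reads off from it that `y` cannot exceed the last power.
    step y (O.≤-respˡ-≈ (R.*-identityʳ a) a≤y) end ,
    O.reflexive (solve 4 (λ x y a i → con (+ 0) :* x :+ (y :- a :* con (+ 1)) :* i := (y :- a) :* i :+ con (+ 0))
      R.refl x y a (y ⁻¹))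
  geometricPartition {x} {b} {y} 1≤b rb≈1 (suc j) a 0<a abʲ≤y =
    step (a * b) a≤ab (proj₁ rest) ,
    O.≤-respˡ-≈ regroup (+-mono-≤ (O.reflexive (R.sym cell)) (proj₂ rest))
    where
    a≤ab : a ≤ a * b
    a≤ab = O.≤-respˡ-≈ (R.*-identityʳ a) (*-monoˡ-≤ (proj₁ 0<a) 1≤b)
    0<ab : 0# < a * b
    0<ab = <-≤-trans 0<a a≤ab
    rest = geometricPartition 1≤b rb≈1 j (a * b) 0<ab (O.≤-respˡ-≈ (R.sym (R.*-assoc a b _)) abʲ≤y)
    cell : (a * b - a) / (a * b) ≈ x
    cell = begin
      (a * b - a) * i                    ≈⟨ R.*-congʳ (R.+-congˡ (R.-‿cong (R.trans (R.*-congˡ rb≈1) (R.*-identityʳ a)))) ⟨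
      (a * b - a * ((1# - x) * b)) * i   ≈⟨ solve 4 (λ a b x i → (a :* b :- a :* ((con (+ 1) :- x) :* b)) :* i := x :* (a :* b :* i)) R.refl a b x i ⟩
      x * (a * b * i)                    ≈⟨ R.*-congˡ (*-inverseʳ _ (0<⇒≉0 0<ab)) ⟩
      x * 1#                             ≈⟨ R.*-identityʳ x ⟩
      x                                  ∎
      where i = (a * b) ⁻¹
    regroup : x + (fromℕ j * x + (y - a * b * b ^ j) / y) ≈ fromℕ (suc j) * x + (y - a * b ^ suc j) / y
    regroup = solve 7 (λ x n y a b c i →
      x :+ (n :* x :+ (y :- a :* b :* c) :* i) := (con (+ 1) :+ n) :* x :+ (y :- a :* (b :* c)) :* i)
      R.refl x (fromℕ j) y a b (b ^ j) (y ⁻¹)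

  -- This plays the part of `1 - x ≤ exp (- x)`, using only the integral. If `b ^ N ≤ y`, the
  -- geometric partition of the interval from 1 to `y` has lower sum at least
  -- `N x + (y - b ^ N) / y`; as `log y ≤ N x` bounds it, the last term is at most 0 and
  -- `y ≤ b ^ N`.
  log≤⇒*^≤1 : ∀ {x y} N → 0# ≤ x → x < 1# → 1# ≤ y → log y ≤ fromℕ N * x → y * (1# - x) ^ N ≤ 1#
  log≤⇒*^≤1 {x} {y} N 0≤x x<1 1≤y log≤ = O.≤-respʳ-≈ (^-inverse (R.trans (R.*-comm b _) rb≈1) N)
    (*-monoʳ-≤ (^-nonneg (proj₁ 0<r) N) y≤bᴺ)
    where
    r = 1# - x
    b = r ⁻¹
    0<r : 0# < r
    0<r = x<y⇒0<y-x x<1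
    rb≈1 : r * b ≈ 1#
    rb≈1 = *-inverseʳ r (0<⇒≉0 0<r)
    0<1 : 0# < 1#
    0<1 = 0≤1 , 0≉1
    0<y : 0# < y
    0<y = <-≤-trans 0<1 1≤y
    1≤b : 1# ≤ b
    1≤b = ≤-by (*-nonneg 0≤x (0<x⇒0≤x⁻¹ 0<r)) (begin
      1# + x * b            ≈⟨ R.+-congʳ rb≈1 ⟨
      (1# - x) * b + x * b  ≈⟨ solve 2 (λ x b → (con (+ 1) :- x) :* b :+ x :* b := b) R.refl x b ⟩
      b                     ∎)
    y≤bᴺ : y ≤ b ^ N
    y≤bᴺ with O.total y (b ^ N)
    ... | inj₁ y≤bᴺ = y≤bᴺ
    ... | inj₂ bᴺ≤y = 0≤y-x⇒x≤y (*-cancelʳ-≤ 0<y (O.≤-respˡ-≈ (R.sym (R.zeroˡ y)) 0≤[bᴺ-y]*y))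
      where
      1*bᴺ≈bᴺ : 1# * b ^ N ≈ b ^ N
      1*bᴺ≈bᴺ = R.*-identityˡ _
      π = geometricPartition 1≤b rb≈1 N 1# 0<1 (O.≤-respˡ-≈ (R.sym 1*bᴺ≈bᴺ) bᴺ≤y)
      Nx+≤Nx : fromℕ N * x + (y - 1# * b ^ N) / y ≤ fromℕ N * x
      Nx+≤Nx = O.trans (proj₂ π) (O.trans (proj₁ (log-isSupremum 1≤y) _ (proj₁ π , R.refl)) log≤)
      0≤[bᴺ-y]*y : 0# ≤ (b ^ N - y) * y
      -- The slack in `Nx+≤Nx` is multiplied by `y * y` to clear the inverse; one factor `y` remains
      -- and is cancelled above.
      0≤[bᴺ-y]*y = O.≤-respʳ-≈ (begin
        (Nx - (Nx + (y - 1# * B) * i)) * (y * y) ≈⟨ solve 4 (λ n y B i → (n :- (n :+ (y :- con (+ 1) :* B) :* i)) :* (y :* y) := (B :- y) :* y :* (y :* i)) R.refl Nx y B i ⟩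
        (B - y) * y * (y * i)                    ≈⟨ R.*-congˡ (*-inverseʳ y (0<⇒≉0 0<y)) ⟩
        (B - y) * y * 1#                         ≈⟨ R.*-identityʳ _ ⟩
        (B - y) * y                              ∎)
        (*-nonneg (x≤y⇒0≤y-x Nx+≤Nx) (*-nonneg (proj₁ 0<y) (proj₁ 0<y)))
        where
        Nx = fromℕ N * x
        B = b ^ N
        i = y ⁻¹

-- Subsets of which a part is already known.

-- For a random A, mix Q K A has the distribution of A conditioned on A ∩ Q ≡ K ∩ Q.
mix : ∀ {n} → Subset n → Subset n → Subset n → Subset n
mix []      []      []      = []
mix (q ∷ Q) (k ∷ K) (a ∷ A) = (if q then k else a) ∷ mix Q K A

mix-⊥ : ∀ {n} (K A : Subset n) → mix ⊥ K A ≡ A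
mix-⊥ []      []      = ≡.refl
mix-⊥ (k ∷ K) (a ∷ A) = cong (a ∷_) (mix-⊥ K A)

-- Within `X` the unknown elements take their status from `S`, so the answer to querying `X` does
-- not depend on `A`.
∩-mix-mix : ∀ {n} (X Q K S A : Subset n) → X ∩ mix Q K (mix X S A) ≡ X ∩ mix Q K S
∩-mix-mix []          []          []      []      []      = ≡.refl
∩-mix-mix (true  ∷ X) (true  ∷ Q) (k ∷ K) (s ∷ S) (a ∷ A) = cong (k ∷_) (∩-mix-mix X Q K S A)
∩-mix-mix (true  ∷ X) (false ∷ Q) (k ∷ K) (s ∷ S) (a ∷ A) = cong (s ∷_) (∩-mix-mix X Q K S A)
∩-mix-mix (false ∷ X) (q     ∷ Q) (k ∷ K) (s ∷ S) (a ∷ A) = cong (false ∷_) (∩-mix-mix X Q K S A)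

-- Conditioning on the past and then on the answer for `X` amounts to conditioning once on the
-- enlarged past `Q ∪ X`. This brings the situation after a round into the shape of the induction
-- hypothesis.
mix-mix : ∀ {n} (X Q K S A : Subset n) → mix Q K (mix X S A) ≡ mix (Q ∪ X) (mix Q K (X ∩ mix Q K S)) A
mix-mix []          []          []      []      []      = ≡.refl
mix-mix (x     ∷ X) (true  ∷ Q) (k ∷ K) (s ∷ S) (a ∷ A) = cong (k ∷_) (mix-mix X Q K S A)
mix-mix (true  ∷ X) (false ∷ Q) (k ∷ K) (s ∷ S) (a ∷ A) = cong (s ∷_) (mix-mix X Q K S A)
mix-mix (false ∷ X) (false ∷ Q) (k ∷ K) (s ∷ S) (a ∷ A) = cong (a ∷_) (mix-mix X Q K S A)

-- Replacing unknown answers by `⊥` leaves exactly the known active elements, and all remaining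
-- chance lies in `X ∩ ∁ Q`. The result is a fixed set joined with a random subset, as
-- `𝔼-submodular` requires.
∩-mix : ∀ {n} (X Q K S : Subset n) → X ∩ mix Q K S ≡ (X ∩ mix Q K ⊥) ∪ ((X ∩ ∁ Q) ∩ S)
∩-mix []          []          []          []      = ≡.refl
∩-mix (false ∷ X) (q     ∷ Q) (k     ∷ K) (s ∷ S) = cong (false ∷_) (∩-mix X Q K S)
∩-mix (true  ∷ X) (true  ∷ Q) (true  ∷ K) (s ∷ S) = cong (true ∷_) (∩-mix X Q K S)
∩-mix (true  ∷ X) (true  ∷ Q) (false ∷ K) (s ∷ S) = cong (false ∷_) (∩-mix X Q K S)
∩-mix (true  ∷ X) (false ∷ Q) (k     ∷ K) (s ∷ S) = cong (s ∷_) (∩-mix X Q K S)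

∪-monoʳ-⊆ : ∀ {n} (X : Subset n) {Y Z} → Y ⊆ Z → X ∪ Y ⊆ X ∪ Z
∪-monoʳ-⊆ X {Y} Y⊆Z x∈ = x∈p∪q⁺ (Sum.map₂ Y⊆Z (x∈p∪q⁻ X Y x∈))

∩-monoʳ-⊆ : ∀ {n} (X : Subset n) {Y Z} → Y ⊆ Z → X ∩ Y ⊆ X ∩ Z
∩-monoʳ-⊆ X {Y} Y⊆Z x∈ = x∈p∩q⁺ (proj₁ (x∈p∩q⁻ X Y x∈) , Y⊆Z (proj₂ (x∈p∩q⁻ X Y x∈)))

∩-mix-⊆ : ∀ {n} (X Q K S : Subset n) → X ∩ mix Q K S ⊆ X ∩ mix Q K ⊤
∩-mix-⊆ X Q K S = ≡.subst₂ _⊆_ (≡.sym (∩-mix X Q K S)) (≡.sym (∩-mix X Q K ⊤))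
  (∪-monoʳ-⊆ (X ∩ mix Q K ⊥) (∩-monoʳ-⊆ (X ∩ ∁ Q) (λ _ → ∈⊤)))

does-∈? : ∀ {n} (e : Fin n) (X : Subset n) → does (e ∈? X) ≡ lookup X e
does-∈? zero    (inside  ∷ X) = ≡.refl
does-∈? zero    (outside ∷ X) = ≡.refl
does-∈? (suc e) (x       ∷ X) = does-∈? e X

-- Reduction of linear functions to submodular ones.

module LinearFunctions (ℝ : CompleteOrderedField) where
  open RealFunctions ℝ
  open StochasticQueries ℝ
  open RealLemmas ℝ

  module _ {n} (w : Fin n → Carrier) (0≤w : ∀ e → 0# ≤ w e) where

    weightIn : Subset n → Fin n → Carrier
    weightIn X e = if lookup X e then w e else 0#

    -- With the index list independent of `X`, monotonicity and modularity can be checked element by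
    -- element.
    ∑-filter : ∀ X es → ∑ (filter (_∈? X) es) w ≈ ∑ es (weightIn X)
    ∑-filter X []       = R.refl
    ∑-filter X (e ∷ es) with does (e ∈? X) | does-∈? e X
    ... | true  | eq rewrite ≡.sym eq = R.+-congˡ (∑-filter X es)
    ... | false | eq rewrite ≡.sym eq = R.trans (∑-filter X es) (R.sym (R.+-identityˡ _))

    weightIn-mono : ∀ {X Y} → X ⊆ Y → ∀ e → weightIn X e ≤ weightIn Y e
    weightIn-mono {X} {Y} X⊆Y e with lookup X e in eqX | lookup Y e in eqY
    ... | true  | true  = O.refl
    ... | true  | false with () ← ≡.trans (≡.sym eqY) ([]=⇒lookup (X⊆Y (lookup⇒[]= e X eqX)))
    ... | false | true  = 0≤w e
    ... | false | false = O.refl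

    weightIn-modular : ∀ X Y e → weightIn (X ∪ Y) e + weightIn (X ∩ Y) e ≈ weightIn X e + weightIn Y e
    weightIn-modular X Y e
      rewrite lookup-zipWith _∨_ e X Y | lookup-zipWith _∧_ e X Y with lookup X e | lookup Y e
    ... | true  | true  = R.refl
    ... | true  | false = R.refl
    ... | false | true  = R.+-comm _ _
    ... | false | false = R.refl

  linear⇒submodular : ∀ {n} (f : Subset n → Carrier) → MonotoneLinear f → MonotoneSubmodular f
  linear⇒submodular {n} f (w , 0≤w , f≈) = monotone , submodular
    where
    f≈′ : ∀ X → f X ≈ ∑ (allFin n) (weightIn w 0≤w X)
    f≈′ X = R.trans (f≈ X) (∑-filter w 0≤w X (allFin n))
    monotone : Monotone f
    monotone X Y X⊆Y = O.≤-respˡ-≈ (R.sym (f≈′ X)) (O.≤-respʳ-≈ (R.sym (f≈′ Y))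
      (∑-mono (allFin n) (weightIn-mono w 0≤w X⊆Y)))
    sum₂ : ∀ X Y → f X + f Y ≈ ∑ (allFin n) (λ e → weightIn w 0≤w X e + weightIn w 0≤w Y e)
    sum₂ X Y = R.trans (R.+-cong (f≈′ X) (f≈′ Y)) (R.sym (∑-+ (allFin n) _ _))
    submodular : Submodular f
    submodular X Y = O.≤-respˡ-≈ (R.sym (sum₂ (X ∪ Y) (X ∩ Y))) (O.≤-respʳ-≈ (R.sym (sum₂ X Y))
      (∑-mono (allFin n) (λ e → O.reflexive (weightIn-modular w 0≤w X Y e))))

-- Expectation over independent active elements.

module Expectation (ℝ : CompleteOrderedField) (p : CompleteOrderedField.Carrier ℝ) where
  open RealFunctions ℝ
  open StochasticQueries ℝ
  open RealLemmas ℝ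
  open import Relation.Binary.Reasoning.Setoid R.setoid

  -- Conditioning on one element at a time allows induction over the ground set; `∑-mass≈𝔼` connects
  -- this form with the sum in `Pr`.
  𝔼 : ∀ {n} → (Subset n → Carrier) → Carrier
  𝔼 {zero}  g = g []
  𝔼 {suc n} g = p * 𝔼 (g ∘ (inside ∷_)) + (1# - p) * 𝔼 (g ∘ (outside ∷_))

  𝔼-cong : ∀ {n} {g h : Subset n → Carrier} → (∀ A → g A ≈ h A) → 𝔼 g ≈ 𝔼 h
  𝔼-cong {zero}  g≈h = g≈h []
  𝔼-cong {suc n} g≈h = R.+-cong (R.*-congˡ (𝔼-cong λ A → g≈h (inside ∷ A))) (R.*-congˡ (𝔼-cong λ A → g≈h (outside ∷ A)))

  mixture-idem : ∀ a → p * a + (1# - p) * a ≈ a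
  mixture-idem = solve 2 (λ p a → p :* a :+ (con (+ 1) :- p) :* a := a) R.refl p

  𝔼-const : ∀ {n} a → 𝔼 {n} (λ _ → a) ≈ a
  𝔼-const {zero}  a = R.refl
  𝔼-const {suc n} a = R.trans (R.+-cong (R.*-congˡ (𝔼-const {n} a)) (R.*-congˡ (𝔼-const {n} a))) (mixture-idem a)

  𝔼-+ : ∀ {n} (g h : Subset n → Carrier) → 𝔼 (λ A → g A + h A) ≈ 𝔼 g + 𝔼 h
  𝔼-+ {zero}  g h = R.refl
  𝔼-+ {suc n} g h = R.trans (R.+-cong (R.*-congˡ (𝔼-+ (g ∘ (inside ∷_)) _)) (R.*-congˡ (𝔼-+ (g ∘ (outside ∷_)) _)))
    (solve 6 (λ p q a b c d → p :* (a :+ b) :+ q :* (c :+ d) := (p :* a :+ q :* c) :+ (p :* b :+ q :* d))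
      R.refl p (1# - p) _ _ _ _)

  𝔼-* : ∀ {n} b (g : Subset n → Carrier) → 𝔼 (λ A → b * g A) ≈ b * 𝔼 g
  𝔼-* {zero}  b g = R.refl
  𝔼-* {suc n} b g = R.trans (R.+-cong (R.*-congˡ (𝔼-* b (g ∘ (inside ∷_)))) (R.*-congˡ (𝔼-* b (g ∘ (outside ∷_)))))
    (solve 5 (λ p q b c d → p :* (b :* c) :+ q :* (b :* d) := b :* (p :* c :+ q :* d)) R.refl p (1# - p) b _ _)

  𝔼-affine : ∀ {n} a b (g : Subset n → Carrier) → 𝔼 (λ A → a + b * g A) ≈ a + b * 𝔼 g
  𝔼-affine {n} a b g = R.trans (𝔼-+ (λ _ → a) (λ A → b * g A)) (R.+-cong (𝔼-const {n} a) (𝔼-* b g))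

  -- This plays the part of the tower property of conditional expectation.
  𝔼-resample : ∀ {n} (X : Subset n) (h : Subset n → Carrier) → 𝔼 (λ S → 𝔼 (λ A → h (mix X S A))) ≈ 𝔼 h
  𝔼-resample []                    h = R.refl
  -- An element of `X` takes its status from `S`, so averaging over its status in `A` changes
  -- nothing.
  𝔼-resample {suc n} (inside ∷ X)  h = R.+-cong (R.*-congˡ (half inside)) (R.*-congˡ (half outside))
    where
    inner : Bool → Subset n → Carrier
    inner s S = 𝔼 (λ A → h (s ∷ mix X S A))
    half : ∀ s → 𝔼 (λ S → p * inner s S + (1# - p) * inner s S) ≈ 𝔼 (λ A → h (s ∷ A))
    half s = R.trans (𝔼-cong {n} λ S → mixture-idem (inner s S)) (𝔼-resample X (λ A → h (s ∷ A)))
  -- Here the status comes from `A`: the average over `S` is idle, and linearity moves the one over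
  -- `A` to the front.
  𝔼-resample {suc n} (outside ∷ X) h = begin
    p * 𝔼 (λ S → p * inner inside S + (1# - p) * inner outside S) +
      (1# - p) * 𝔼 (λ S → p * inner inside S + (1# - p) * inner outside S)
      ≈⟨ mixture-idem _ ⟩
    𝔼 (λ S → p * inner inside S + (1# - p) * inner outside S)
      ≈⟨ 𝔼-+ (λ S → p * inner inside S) (λ S → (1# - p) * inner outside S) ⟩
    𝔼 (λ S → p * inner inside S) + 𝔼 (λ S → (1# - p) * inner outside S)
      ≈⟨ R.+-cong (𝔼-* p (inner inside)) (𝔼-* (1# - p) (inner outside)) ⟩
    p * 𝔼 (inner inside) + (1# - p) * 𝔼 (inner outside)
      ≈⟨ R.+-cong (R.*-congˡ (𝔼-resample X (h ∘ (inside ∷_)))) (R.*-congˡ (𝔼-resample X (h ∘ (outside ∷_)))) ⟩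
    𝔼 h ∎
    where
    inner : Bool → Subset n → Carrier
    inner s S = 𝔼 (λ A → h (s ∷ mix X S A))

  -- The factor `a` is general because the induction absorbs into it the probability of each element
  -- split off; it starts as the probability of the seed.
  ∑-mass≈𝔼 : ∀ n a (g : Subset n → Carrier) → ∑ (allSubsets n) (λ A → (a * mass p A) * g A) ≈ a * 𝔼 g
  ∑-mass≈𝔼 zero    a g = R.trans (R.+-identityʳ _) (R.*-congʳ (R.*-identityʳ a))
  ∑-mass≈𝔼 (suc n) a g = begin
    ∑ (List.map (inside ∷_) As ++ List.map (outside ∷_) As) G
      ≈⟨ ∑-++ (List.map (inside ∷_) As) _ G ⟩
    ∑ (List.map (inside ∷_) As) G + ∑ (List.map (outside ∷_) As) G
      ≡⟨ cong₂ _+_ (∑-map (inside ∷_) As G) (∑-map (outside ∷_) As G) ⟩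
    ∑ As (G ∘ (inside ∷_)) + ∑ As (G ∘ (outside ∷_))
      ≈⟨ R.+-cong (∑-cong As λ A → R.*-congʳ (R.sym (R.*-assoc a p (mass p A))))
                  (∑-cong As λ A → R.*-congʳ (R.sym (R.*-assoc a (1# - p) (mass p A)))) ⟩
    ∑ As (λ A → (a * p * mass p A) * g (inside ∷ A)) + ∑ As (λ A → (a * (1# - p) * mass p A) * g (outside ∷ A))
      ≈⟨ R.+-cong (∑-mass≈𝔼 n (a * p) _) (∑-mass≈𝔼 n (a * (1# - p)) _) ⟩
    a * p * 𝔼 (g ∘ (inside ∷_)) + a * (1# - p) * 𝔼 (g ∘ (outside ∷_))
      ≈⟨ solve 5 (λ a p q b c → a :* p :* b :+ a :* q :* c := a :* (p :* b :+ q :* c)) R.refl a p (1# - p) _ _ ⟩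
    a * 𝔼 g ∎
    where
    As = allSubsets n
    G : Subset (suc n) → Carrier
    G A = (a * mass p A) * g A

  -- The indicator of disjointness of `R` and `S`, defined along the recursion of `𝔼` so that its
  -- expectation is a power by induction.
  avoids : ∀ {n} → Subset n → Subset n → Carrier
  avoids []            []            = 1#
  avoids (outside ∷ R) (s       ∷ S) = avoids R S
  avoids (inside  ∷ R) (inside  ∷ S) = 0#
  avoids (inside  ∷ R) (outside ∷ S) = avoids R S

  avoids-cases : ∀ {n} (R S : Subset n) → avoids R S ≡ 0# ⊎ (avoids R S ≡ 1# × R ∩ S ≡ ⊥)
  avoids-cases []            []            = inj₂ (≡.refl , ≡.refl)
  avoids-cases (outside ∷ R) (s       ∷ S) = Sum.map₂ (λ (e , e′) → e , cong (outside ∷_) e′) (avoids-cases R S)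
  avoids-cases (inside  ∷ R) (inside  ∷ S) = inj₁ ≡.refl
  avoids-cases (inside  ∷ R) (outside ∷ S) = Sum.map₂ (λ (e , e′) → e , cong (outside ∷_) e′) (avoids-cases R S)

  𝔼-avoids : ∀ {n} (R : Subset n) → 𝔼 (avoids R) ≈ (1# - p) ^ ∣ R ∣
  𝔼-avoids []            = R.refl
  𝔼-avoids (outside ∷ R) = R.trans (mixture-idem _) (𝔼-avoids R)
  𝔼-avoids {suc n} (inside ∷ R) = begin
    p * 𝔼 {n} (λ _ → 0#) + (1# - p) * 𝔼 (avoids R)  ≈⟨ R.+-cong (R.*-congˡ (𝔼-const {n} 0#)) (R.*-congˡ (𝔼-avoids R)) ⟩
    p * 0# + (1# - p) * (1# - p) ^ ∣ R ∣             ≈⟨ R.+-congʳ (R.zeroʳ p) ⟩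
    0# + (1# - p) * (1# - p) ^ ∣ R ∣                 ≈⟨ R.+-identityˡ _ ⟩
    (1# - p) * (1# - p) ^ ∣ R ∣                      ∎

  module _ (0≤p : 0# ≤ p) (p≤1 : p ≤ 1#) where

    𝔼-mono : ∀ {n} {g h : Subset n → Carrier} → (∀ A → g A ≤ h A) → 𝔼 g ≤ 𝔼 h
    𝔼-mono {zero}  g≤h = g≤h []
    𝔼-mono {suc n} g≤h = +-mono-≤ (*-monoˡ-≤ 0≤p (𝔼-mono λ A → g≤h (inside ∷ A)))
      (*-monoˡ-≤ (x≤y⇒0≤y-x p≤1) (𝔼-mono λ A → g≤h (outside ∷ A)))

    -- Induction on the elements. Conditioning on the first one, if it lies in the set, leaves four
    -- values; submodularity for this element and the rest of the set, weighted by `p * (1# - p)`,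
    -- trades the two mixed values for the two extreme ones.
    𝔼-submodular : ∀ {n} (g : Subset n → Carrier) → Submodular g → ∀ R →
                   (1# - p) * g ⊥ + p * g R ≤ 𝔼 (λ S → g (R ∩ S))
    𝔼-submodular g sub []            = O.reflexive (R.trans (R.+-comm _ _) (mixture-idem _))
    𝔼-submodular g sub (outside ∷ R) = O.≤-respʳ-≈ (R.sym (mixture-idem _))
      (𝔼-submodular (g ∘ (outside ∷_)) (λ X Y → sub (outside ∷ X) (outside ∷ Y)) R)
    𝔼-submodular g sub (inside ∷ R)  = O.trans
      (≤-by (*-nonneg (*-nonneg 0≤p (x≤y⇒0≤y-x p≤1)) (x≤y⇒0≤y-x exchange))
        (solve 5 (λ p g₀₀ g₀ᵣ g₁₀ g₁ᵣ → let q = con (+ 1) :- p in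
          (q :* g₀₀ :+ p :* g₁ᵣ) :+ p :* q :* ((g₁₀ :+ g₀ᵣ) :- (g₁ᵣ :+ g₀₀)) :=
          p :* (q :* g₁₀ :+ p :* g₁ᵣ) :+ q :* (q :* g₀₀ :+ p :* g₀ᵣ))
          R.refl p (g (outside ∷ ⊥)) (g (outside ∷ R)) (g (inside ∷ ⊥)) (g (inside ∷ R))))
      (+-mono-≤ (*-monoˡ-≤ 0≤p (𝔼-submodular (g ∘ (inside ∷_)) (λ X Y → sub (inside ∷ X) (inside ∷ Y)) R))
        (*-monoˡ-≤ (x≤y⇒0≤y-x p≤1) (𝔼-submodular (g ∘ (outside ∷_)) (λ X Y → sub (outside ∷ X) (outside ∷ Y)) R)))
      where
      exchange : g (inside ∷ R) + g (outside ∷ ⊥) ≤ g (inside ∷ ⊥) + g (outside ∷ R)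
      exchange = ≡.subst₂ (λ X Y → g (inside ∷ X) + g (outside ∷ Y) ≤ g (inside ∷ ⊥) + g (outside ∷ R))
        (∪-identityˡ R) (∩-zeroˡ R) (sub (inside ∷ ⊥) (outside ∷ R))

-- The greedy strategy and its success probability.

module AdaptiveQueries (ℝ : CompleteOrderedField) where
  open RealFunctions ℝ
  open StochasticQueries ℝ
  open RealLemmas ℝ

  module Greedy
    {n : ℕ} (D : List⁺ (Subset n)) (k : ℕ) (1≤k : 1 ℕ.≤ k) (size≤k : ∀ X → X ∈ toList D → ∣ X ∣ ℕ.≤ k)
    (f : Subset n → Carrier) (0≤f : NonNegative f) (mono : Monotone f) (sub : Submodular f)
    (p : Carrier) (0≤p : 0# ≤ p) (p≤1 : p ≤ 1#)
    -- `c` is the approximation factor and `x` the success probability guaranteed per round, later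
    -- `ε * p`; the final equation ties them together.
    (c : Carrier) (0≤c : 0# ≤ c) (c<1 : c < 1#)
    (x : Carrier) (0≤x : 0# ≤ x) (x≤1 : x ≤ 1#)
    (c[1-s]+x≈p : c * (1# - (1# - p) ^ k) + x ≈ p)
    where
    open Expectation ℝ p
    open import Relation.Binary.Reasoning.Setoid R.setoid hiding (stop)

    0≤1-p : 0# ≤ 1# - p
    0≤1-p = x≤y⇒0≤y-x p≤1

    ∪-submodular : ∀ K → Submodular (λ T → f (K ∪ T))
    ∪-submodular K X Y = ≡.subst₂ (λ S T → f S + f T ≤ f (K ∪ X) + f (K ∪ Y))
      (≡.sym (∙-distrˡ-∙ (∪-idempotentCommutativeMonoid n) K X Y)) (≡.sym (∪-distribˡ-∩ K X Y))
      (sub (K ∪ X) (K ∪ Y))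

    -- Plain reverse Markov only yields the factor p; the term for `avoids N`, the event that nothing
    -- unqueried in X is active, improves it to p / (1 - (1 - p) ^ k).
    query-succeeds : ∀ X → X ∈ toList D → ∀ Q K →
                     x ≤ 𝔼 (λ S → 𝟙 (c * f (X ∩ mix Q K ⊤) ≤? f (X ∩ mix Q K S)))
    query-succeeds X X∈D Q K = go (c * U ≤? κ)
      where
      K₀ = X ∩ mix Q K ⊥
      N = X ∩ ∁ Q
      U = f (X ∩ mix Q K ⊤)
      κ = f K₀
      s = (1# - p) ^ k
      v : Subset n → Carrier
      v S = f (X ∩ mix Q K S)
      success? : ∀ S → Dec (c * U ≤ v S)
      success? S = c * U ≤? v S
      v≡ : ∀ S → v S ≡ f (K₀ ∪ (N ∩ S))
      v≡ S = cong f (∩-mix X Q K S)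
      U≡ : U ≡ f (K₀ ∪ N)
      U≡ = ≡.trans (v≡ ⊤) (cong (λ T → f (K₀ ∪ T)) (∩-identityʳ N))
      κ≡ : κ ≡ f (K₀ ∪ ⊥)
      κ≡ = cong f (≡.sym (∪-identityʳ K₀))
      κ≤v : ∀ S → κ ≤ v S
      κ≤v S = O.≤-respʳ-≈ (R.reflexive (≡.sym (v≡ S))) (mono _ _ (p⊆p∪q (N ∩ S)))
      v≤U : ∀ S → v S ≤ U
      v≤U S = mono _ _ (∩-mix-⊆ X Q K S)
      s≤1-p : s ≤ 1# - p
      s≤1-p = O.≤-respʳ-≈ (R.*-identityʳ _) (^-antimono 0≤1-p (1-x≤1 0≤p) 1≤k)
      s≤𝔼-avoids : s ≤ 𝔼 (avoids N)
      s≤𝔼-avoids = O.≤-respʳ-≈ (R.sym (𝔼-avoids N))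
        (^-antimono 0≤1-p (1-x≤1 0≤p) (ℕ.≤-trans (∣p∩q∣≤∣p∣ X (∁ Q)) (size≤k X X∈D)))
      𝔼v≥ : (1# - p) * κ + p * U ≤ 𝔼 v
      𝔼v≥ = O.≤-respˡ-≈ (R.reflexive (≡.sym (cong₂ (λ a b → (1# - p) * a + p * b) κ≡ U≡)))
        (O.≤-respʳ-≈ (𝔼-cong λ S → R.reflexive (≡.sym (v≡ S)))
          (𝔼-submodular 0≤p p≤1 (λ T → f (K₀ ∪ T)) (∪-submodular K₀) N))

      go : Dec (c * U ≤ κ) → x ≤ 𝔼 (λ S → 𝟙 (success? S))
      -- The known active part already reaches the threshold, so every `S` is a success.
      go (yes cU≤κ) = O.trans x≤1 (O.≤-respˡ-≈ (𝔼-const {n} 1#)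
        (𝔼-mono 0≤p p≤1 λ S → 1≤𝟙 (success? S) (O.trans cU≤κ (κ≤v S))))
      -- After multiplication by `(1# - c) * U`, the gap is a sum of nonnegative terms: the slacks
      -- in `𝔼-pointwise`, `𝔼v≥`, `s≤𝔼-avoids` and `s≤1-p`, the latter two weighted by `c * U - κ`
      -- and `κ`. They even give `x * U` on the left, whence the surplus `c * U * x`.
      go (no cU≰κ) = *-cancelʳ-≤ (*-pos (x<y⇒0<y-x c<1) 0<U) (≤-by
        (+-nonneg (+-nonneg (+-nonneg (x≤y⇒0≤y-x 𝔼-pointwise) (x≤y⇒0≤y-x 𝔼v≥))
          (+-nonneg (*-nonneg (x≤y⇒0≤y-x s≤𝔼-avoids) 0≤cU-κ) (*-nonneg (x≤y⇒0≤y-x s≤1-p) (0≤f K₀))))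
          (*-nonneg (*-nonneg 0≤c (proj₁ 0<U)) 0≤x))
        (begin
          x * ((1# - c) * U) + (((c * U + (1# - c) * U * g - (𝔼 v + (c * U - κ) * r)) + (𝔼 v - ((1# - p) * κ + p * U))
            + ((r - s) * (c * U - κ) + (1# - p - s) * κ)) + c * U * x)
            ≈⟨ solve 9 (λ x c U g v κ r p s → let 1# = con (+ 1) in
               x :* ((1# :- c) :* U) :+ (((c :* U :+ (1# :- c) :* U :* g :- (v :+ (c :* U :- κ) :* r)) :+ (v :- ((1# :- p) :* κ :+ p :* U))
                 :+ ((r :- s) :* (c :* U :- κ) :+ (1# :- p :- s) :* κ)) :+ c :* U :* x)
               := g :* ((1# :- c) :* U) :+ ((c :* (1# :- s) :+ x) :- p) :* U) R.refl x c U g (𝔼 v) κ r p s ⟩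
          g * ((1# - c) * U) + ((c * (1# - s) + x) - p) * U
            ≈⟨ R.+-congˡ (R.*-congʳ (R.+-congʳ c[1-s]+x≈p)) ⟩
          g * ((1# - c) * U) + (p - p) * U
            ≈⟨ solve 3 (λ a p U → a :+ (p :- p) :* U := a) R.refl _ p U ⟩
          g * ((1# - c) * U) ∎))
        where
        g = 𝔼 (λ S → 𝟙 (success? S))
        r = 𝔼 (avoids N)
        0≤cU-κ : 0# ≤ c * U - κ
        0≤cU-κ = x≤y⇒0≤y-x (proj₁ (≰⇒> cU≰κ))
        0<U : 0# < U
        0<U = ≰⇒> λ U≤0 → cU≰κ (O.trans (*-monoˡ-≤ 0≤c U≤0) (O.≤-respˡ-≈ (R.sym (R.zeroʳ c)) (0≤f K₀)))
        0≤[1-c]U : 0# ≤ (1# - c) * U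
        0≤[1-c]U = *-nonneg (x≤y⇒0≤y-x (proj₁ c<1)) (proj₁ 0<U)
        -- On success `v S` is at most `U`, on failure at most `c * U`. If nothing in `N` is active,
        -- `v S` equals `κ`, and the added term lifts it exactly to `c * U`; this is the gain over
        -- plain reverse Markov.
        pointwise : ∀ S → v S + (c * U - κ) * avoids N S ≤ c * U + (1# - c) * U * 𝟙 (success? S)
        pointwise S with avoids-cases N S
        ... | inj₂ (eq , N∩S≡⊥) rewrite eq = O.≤-respˡ-≈ (begin
          c * U                     ≈⟨ solve 2 (λ a b → b := a :+ (b :- a) :* con (+ 1)) R.refl κ (c * U) ⟩
          κ + (c * U - κ) * 1#      ≡⟨ cong (λ a → a + (c * U - κ) * 1#) (≡.trans κ≡ (≡.trans (cong (λ T → f (K₀ ∪ T)) (≡.sym N∩S≡⊥)) (≡.sym (v≡ S)))) ⟩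
          v S + (c * U - κ) * 1#    ∎)
          (≤-by (*-nonneg 0≤[1-c]U (0≤𝟙 (success? S))) R.refl)
        ... | inj₁ eq rewrite eq = O.≤-respˡ-≈ (solve 2 (λ a b → a := a :+ b :* con (+ 0)) R.refl (v S) (c * U - κ)) (bound (success? S))
          where
          bound : (d : Dec (c * U ≤ v S)) → v S ≤ c * U + (1# - c) * U * 𝟙 d
          bound (yes _)     = O.≤-respʳ-≈ (solve 2 (λ c U → U := c :* U :+ (con (+ 1) :- c) :* U :* con (+ 1)) R.refl c U) (v≤U S)
          bound (no cU≰vS) = O.≤-respʳ-≈ (solve 2 (λ c U → c :* U := c :* U :+ (con (+ 1) :- c) :* U :* con (+ 0)) R.refl c U) (proj₁ (≰⇒> cU≰vS))
        𝔼-pointwise : 𝔼 v + (c * U - κ) * r ≤ c * U + (1# - c) * U * g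
        𝔼-pointwise = O.≤-respˡ-≈ (R.trans (𝔼-+ v (λ S → (c * U - κ) * avoids N S)) (R.+-congˡ (𝔼-* (c * U - κ) (avoids N))))
          (O.≤-respʳ-≈ (𝔼-affine (c * U) ((1# - c) * U) (λ S → 𝟙 (success? S))) (𝔼-mono 0≤p p≤1 pointwise))

    best : ∀ Q K → ∃ λ X → X ∈ toList D × max D (λ Z → f (Z ∩ mix Q K ⊤)) ≤ f (X ∩ mix Q K ⊤)
    best Q K = argmax D (λ Z → f (Z ∩ mix Q K ⊤))

    -- The state consists of the queried set `Q` and a record `K` that matters only on `Q`. Taking
    -- `mix Q K S` as the new record keeps old answers and adds those for `X`.
    greedy : ∀ N → (Q K : Subset n) → DecisionTree D N
    greedy zero    Q K = stop
    greedy (suc N) Q K = let X , X∈D , _ = best Q K in query X X∈D λ S → greedy N (Q ∪ X) (mix Q K S)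

    good? : ∀ V A → Dec (c * max D (λ Z → f (Z ∩ A)) ≤ max D (λ X → f ((X ∩ A) ∩ V)))
    good? V A = c * max D (λ Z → f (Z ∩ A)) ≤? max D (λ X → f ((X ∩ A) ∩ V))

    -- A general past `(Q , K)` makes the induction work. If the first query reaches `c * U`,
    -- success is certain; otherwise the later rounds succeed with probability at least `1# - β`.
    -- Averaging gives at least `(1# - β) + β * x`.
    greedy-succeeds : ∀ N Q K → 1# - (1# - x) ^ N ≤
      𝔼 (λ A → 𝟙 (good? (Q ∪ queried (greedy N Q K) (mix Q K A)) (mix Q K A)))
    greedy-succeeds zero Q K = O.≤-respˡ-≈ (R.trans (𝔼-const {n} 0#) (R.sym (R.-‿inverseʳ 1#)))
      (𝔼-mono 0≤p p≤1 λ A → 0≤𝟙 (good? (Q ∪ ⊥) (mix Q K A)))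
    greedy-succeeds (suc N) Q K = O.trans
      (O.≤-respˡ-≈ (solve 2 (λ x β → (con (+ 1) :- β) :+ β :* x := con (+ 1) :- (con (+ 1) :- x) :* β) R.refl x β)
        (+-monoʳ-≤ (1# - β) (*-monoˡ-≤ 0≤β (query-succeeds X X∈D Q K))))
      (O.≤-respˡ-≈ (𝔼-affine (1# - β) β (λ S → 𝟙 (success? S)))
        -- The active set is drawn in two stages: `S` decides the answer for `X`, and a fresh `A`
        -- decides the elements outside it.
        (O.≤-respʳ-≈ (𝔼-resample X (λ A → h (mix Q K A)))
          (𝔼-mono 0≤p p≤1 λ S → bound S (success? S))))
      where
      β = (1# - x) ^ N
      X = proj₁ (best Q K)
      X∈D = proj₁ (proj₂ (best Q K))
      0≤β : 0# ≤ β
      0≤β = ^-nonneg (x≤y⇒0≤y-x x≤1) N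
      U = f (X ∩ mix Q K ⊤)
      success? : ∀ S → Dec (c * U ≤ f (X ∩ mix Q K S))
      success? S = c * U ≤? f (X ∩ mix Q K S)
      V : Subset n → Subset n
      V A = Q ∪ queried (greedy (suc N) Q K) A
      h : Subset n → Carrier
      h A = 𝟙 (good? (V A) A)
      optimum≤U : ∀ A → max D (λ Z → f (Z ∩ mix Q K A)) ≤ U
      optimum≤U A = O.trans (max-mono D λ Z → mono _ _ (∩-mix-⊆ Z Q K A)) (proj₂ (proj₂ (best Q K)))
      -- The optimistic value `U` bounds the optimum for every completion of the past, and `X` has
      -- been queried in full, so its value counts towards the maximum achieved.
      good : ∀ S A → c * U ≤ f (X ∩ mix Q K S) → 1# ≤ h (mix Q K (mix X S A))
      good S A cU≤ = 1≤𝟙 (good? (V A′) A′) (O.trans (*-monoˡ-≤ 0≤c (optimum≤U (mix X S A)))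
        (O.trans cU≤ (O.trans (O.≤-respˡ-≈ (R.reflexive (cong f (∩-mix-mix X Q K S A))) (mono _ _ sub′))
          (g≤max D (λ Y → f ((Y ∩ A′) ∩ V A′)) X∈D))))
        where
        A′ = mix Q K (mix X S A)
        sub′ : X ∩ A′ ⊆ (X ∩ A′) ∩ V A′
        sub′ e∈ = x∈p∩q⁺ (e∈ , q⊆p∪q Q _ (p⊆p∪q _ (p∩q⊆p X A′ e∈)))
      K′ : Subset n → Subset n
      K′ S = mix Q K (X ∩ mix Q K S)
      -- The tree branches on the true answer, which `∩-mix-mix` shows to be the one given by `S`.
      -- What follows is therefore the greedy strategy from the state `Q ∪ X`, `K′ S`.
      h≡ : ∀ S A → let A′ = mix (Q ∪ X) (K′ S) A in
           𝟙 (good? ((Q ∪ X) ∪ queried (greedy N (Q ∪ X) (K′ S)) A′) A′) ≡ h (mix Q K (mix X S A))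
      h≡ S A = ≡.trans (cong (λ V → 𝟙 (good? V A′)) (≡.trans
          (cong (λ T → (Q ∪ X) ∪ queried (greedy N (Q ∪ X) (mix Q K T)) A′)
            (≡.trans (≡.sym (∩-mix-mix X Q K S A)) (cong (X ∩_) (mix-mix X Q K S A))))
          (∪-assoc Q X _)))
        (cong h (≡.sym (mix-mix X Q K S A)))
        where A′ = mix (Q ∪ X) (K′ S) A
      bound : ∀ S (d : Dec (c * U ≤ f (X ∩ mix Q K S))) → (1# - β) + β * 𝟙 d ≤ 𝔼 (λ A → h (mix Q K (mix X S A)))
      bound S (yes cU≤) = O.≤-respˡ-≈
        (R.trans (𝔼-const {n} 1#) (solve 1 (λ β → con (+ 1) := (con (+ 1) :- β) :+ β :* con (+ 1)) R.refl β))
        (𝔼-mono 0≤p p≤1 λ A → good S A cU≤)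
      bound S (no _) = O.≤-respˡ-≈ (solve 1 (λ β → con (+ 1) :- β := (con (+ 1) :- β) :+ β :* con (+ 0)) R.refl β)
        (O.≤-respʳ-≈ (𝔼-cong λ A → R.reflexive (h≡ S A)) (greedy-succeeds N (Q ∪ X) (K′ S)))

  -- Arithmetic of the approximation factor.

  module ApproximationFactor
    {p ε : Carrier} (0<p : 0# < p) (p<1 : p < 1#) (0<ε : 0# < ε) (ε<1 : ε < 1#)
    (k : ℕ) (1≤k : 1 ℕ.≤ k)
    where
    open import Relation.Binary.Reasoning.Setoid R.setoid

    q factor : Carrier
    q      = 1# - (1# - p) ^ k
    factor = ((1# - ε) * p) / q

    p≤q : p ≤ q
    p≤q = ≤-by (x≤y⇒0≤y-x s≤1-p) (solve 2 (λ p s → p :+ ((con (+ 1) :- p) :* con (+ 1) :- s) := con (+ 1) :- s) R.refl p ((1# - p) ^ k))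
      where
      s≤1-p : (1# - p) ^ k ≤ (1# - p) ^ 1
      s≤1-p = ^-antimono (x≤y⇒0≤y-x (proj₁ p<1)) (1-x≤1 (proj₁ 0<p)) 1≤k

    0<q : 0# < q
    0<q = <-≤-trans 0<p p≤q

    0≤1-ε : 0# ≤ 1# - ε
    0≤1-ε = x≤y⇒0≤y-x (proj₁ ε<1)

    factor*q≈ : factor * q ≈ (1# - ε) * p
    factor*q≈ = x/y*y≈x _ 0<q

    factor*q+εp≈p : factor * q + ε * p ≈ p
    factor*q+εp≈p = R.trans (R.+-congʳ factor*q≈) (solve 2 (λ ε p → (con (+ 1) :- ε) :* p :+ ε :* p := p) R.refl ε p)

    0≤factor : 0# ≤ factor
    0≤factor = *-nonneg (*-nonneg 0≤1-ε (proj₁ 0<p)) (0<x⇒0≤x⁻¹ 0<q)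

    -- Were the factor at least `1#`, then `factor * q` would be at least `q`, hence at least `p`;
    -- but it falls short of `p` by `ε * p`.
    factor<1 : factor < 1#
    factor<1 = ≰⇒> λ 1≤factor → <⇒≱ (*-pos 0<ε 0<p) (0≤y-x⇒x≤y (O.≤-respʳ-≈
      (begin
        factor * q - p                       ≈⟨ R.+-congˡ (R.-‿cong factor*q+εp≈p) ⟨
        factor * q - (factor * q + ε * p)    ≈⟨ solve 2 (λ a b → a :- (a :+ b) := con (+ 0) :- b) R.refl (factor * q) (ε * p) ⟩
        0# - ε * p                           ∎)
      (x≤y⇒0≤y-x (O.trans p≤q (O.≤-respˡ-≈ (R.*-identityˡ q) (*-monoʳ-≤ (proj₁ 0<q) 1≤factor))))))

    -- Clearing both denominators turns this into `q ≤ fromℕ k * p`, scaled by `1# - ε`.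
    factor-lower-bound : (1# - ε) / fromℕ k ≤ factor
    factor-lower-bound = *-cancelʳ-≤ (*-pos 0<q 0<k) (O.≤-respˡ-≈ lhs≈ (O.≤-respʳ-≈ rhs≈
      (*-monoˡ-≤ 0≤1-ε (bernoulli (proj₁ 0<p) (proj₁ p<1) k))))
      where
      K = fromℕ k
      positive : ∀ {k} → 1 ℕ.≤ k → 0# < fromℕ k
      positive (ℕ.s≤s {n = k} _) = <-≤-trans (0≤1 , 0≉1) (≤-by (fromℕ-nonneg k) R.refl)
      0<k : 0# < K
      0<k = positive 1≤k
      lhs≈ : (1# - ε) * q ≈ (1# - ε) / K * (q * K)
      lhs≈ = begin
        (1# - ε) * q            ≈⟨ R.*-congʳ (x/y*y≈x (1# - ε) 0<k) ⟨
        (1# - ε) / K * K * q    ≈⟨ solve 3 (λ a K q → a :* K :* q := a :* (q :* K)) R.refl ((1# - ε) / K) K q ⟩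
        (1# - ε) / K * (q * K)  ∎
      rhs≈ : (1# - ε) * (K * p) ≈ factor * (q * K)
      rhs≈ = begin
        (1# - ε) * (K * p)      ≈⟨ solve 3 (λ a K p → a :* (K :* p) := a :* p :* K) R.refl (1# - ε) K p ⟩
        (1# - ε) * p * K        ≈⟨ R.*-congʳ factor*q≈ ⟨
        factor * q * K          ≈⟨ R.*-assoc _ _ _ ⟩
        factor * (q * K)        ∎

  -- The number of rounds and the resulting failure probability.

  module NumberOfRounds
    {p ε δ : Carrier} (0<p : 0# < p) (p<1 : p < 1#) (0<ε : 0# < ε) (ε<1 : ε < 1#) (0<δ : 0# < δ)
    where
    open import Algebra.Construct.NaturalChoice.Min O.totalOrder using (x⊓y≤x; x⊓y≤y; ⊓-sel)

    m y L : Carrier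
    m = δ ⊓ ε
    y = 1# / m
    L = log y

    rounds : ℕ
    -- The leading `1#` is the constant `C`, written out so that this is literally the bound in the
    -- theorem.
    rounds = ⌈ (1# * L) / ((p ^ 2) * ε) ⌉

    0<m : 0# < m
    0<m with ⊓-sel δ ε
    ... | inj₁ m≈δ = <-≤-trans 0<δ (O.reflexive (R.sym m≈δ))
    ... | inj₂ m≈ε = <-≤-trans 0<ε (O.reflexive (R.sym m≈ε))

    ym≈1 : y * m ≈ 1#
    ym≈1 = x/y*y≈x 1# 0<m

    1≤y : 1# ≤ y
    1≤y = *-cancelʳ-≤ 0<m (O.≤-respˡ-≈ (R.sym (R.*-identityˡ m)) (O.≤-respʳ-≈ (R.sym ym≈1)
      (O.trans (x⊓y≤y δ ε) (proj₁ ε<1))))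

    εp<1 : ε * p < 1#
    εp<1 = ≤-<-trans (O.≤-respʳ-≈ (R.*-identityʳ ε) (*-monoˡ-≤ (proj₁ 0<ε) (proj₁ p<1))) ε<1

    0<εp : 0# < ε * p
    0<εp = *-pos 0<ε 0<p

    -- Rounding up gives the bound with `(p ^ 2) * ε`; since `p ≤ 1#`, it passes to the per-round
    -- success probability `ε * p`.
    L≤rounds*εp : L ≤ fromℕ rounds * (ε * p)
    L≤rounds*εp = O.trans
      (O.≤-respˡ-≈ (R.trans (x/y*y≈x (1# * L) 0<p²ε) (R.*-identityˡ L)) (*-monoʳ-≤ (proj₁ 0<p²ε) (x≤⌈x⌉ _)))
      (*-monoˡ-≤ (fromℕ-nonneg rounds) p²ε≤εp)
      where
      0<p²ε : 0# < (p ^ 2) * ε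
      0<p²ε = *-pos (*-pos 0<p (*-pos 0<p (0≤1 , 0≉1))) 0<ε
      p²ε≤εp : (p ^ 2) * ε ≤ ε * p
      p²ε≤εp = ≤-by (*-nonneg (proj₁ 0<εp) (x≤y⇒0≤y-x (proj₁ p<1)))
        (solve 2 (λ p ε → (p :* (p :* con (+ 1))) :* ε :+ ε :* p :* (con (+ 1) :- p) := ε :* p) R.refl p ε)

    -- As `y * m ≈ 1#`, cancelling `y` in the conclusion of `log≤⇒*^≤1` bounds the power by `m`, the
    -- minimum of `δ` and `ε`.
    failure≤δ : (1# - ε * p) ^ rounds ≤ δ
    failure≤δ = O.trans (*-cancelʳ-≤ 0<y (O.≤-respˡ-≈ (R.*-comm y _) (O.≤-respʳ-≈ (R.trans (R.sym ym≈1) (R.*-comm y m))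
        (log≤⇒*^≤1 rounds (proj₁ 0<εp) εp<1 1≤y L≤rounds*εp))))
      (x⊓y≤x δ ε)
      where
      0<y : 0# < y
      0<y = <-≤-trans (0≤1 , 0≉1) 1≤y

lemma4p9 : (ℝ : CompleteOrderedField) →
    let open RealFunctions ℝ
        open StochasticQueries ℝ
    in
    ∃ λ (C : Carrier) → 0# < C ×
      ((p : Carrier) → 0# < p → p < 1# →
       (k : ℕ) → 1 ℕ.≤ k →
       (n : ℕ) (D : List⁺ (Subset n)) → (∀ X → X ∈ toList D → ∣ X ∣ ℕ.≤ k) →
       (f : Subset n → Carrier) → NonNegative f → MonotoneLinear f ⊎ MonotoneSubmodular f →
       (ε δ : Carrier) → 0# < ε → ε < 1# → 0# < δ → δ < 1# →
       let factor = ((1# - ε) * p) / (1# - (1# - p) ^ k)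
       in
       (∃ λ (N : ℕ) → N ℕ.≤ ⌈ (C * log (1# / (δ ⊓ ε))) / ((p ^ 2) * ε) ⌉ ×
          Σ (QueryStrategy D N) λ σ → HasApproximationFactor p f σ factor δ)
       × ((1# - ε) / fromℕ k ≤ factor))
lemma4p9 ℝ = 1# , (0≤1 , 0≉1) , proof
  where
  open RealFunctions ℝ
  open StochasticQueries ℝ
  open RealLemmas ℝ
  open AdaptiveQueries ℝ
  open LinearFunctions ℝ using (linear⇒submodular)

  proof : (p : Carrier) → 0# < p → p < 1# →
    (k : ℕ) → 1 ℕ.≤ k →
    (n : ℕ) (D : List⁺ (Subset n)) → (∀ X → X ∈ toList D → ∣ X ∣ ℕ.≤ k) →
    (f : Subset n → Carrier) → NonNegative f → MonotoneLinear f ⊎ MonotoneSubmodular f →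
    (ε δ : Carrier) → 0# < ε → ε < 1# → 0# < δ → δ < 1# →
    let factor = ((1# - ε) * p) / (1# - (1# - p) ^ k)
    in
    (∃ λ (N : ℕ) → N ℕ.≤ ⌈ (1# * log (1# / (δ ⊓ ε))) / ((p ^ 2) * ε) ⌉ ×
      Σ (QueryStrategy D N) λ σ → HasApproximationFactor p f σ factor δ)
    × ((1# - ε) / fromℕ k ≤ factor)
  proof p 0<p p<1 k 1≤k n D size≤k f 0≤f lin⊎sub ε δ 0<ε ε<1 0<δ _ =
    (rounds , ℕ.≤-refl , σ , success) , factor-lower-bound
    where
    open ApproximationFactor 0<p p<1 0<ε ε<1 k 1≤k
    open NumberOfRounds 0<p p<1 0<ε ε<1 0<δ
    open Expectation ℝ p using (𝔼; 𝔼-cong; ∑-mass≈𝔼)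
    monosub : MonotoneSubmodular f
    monosub = [ linear⇒submodular f , id ]′ lin⊎sub
    open Greedy D k 1≤k size≤k f 0≤f (proj₁ monosub) (proj₂ monosub)
      p (proj₁ 0<p) (proj₁ p<1) factor 0≤factor factor<1 (ε * p) (proj₁ 0<εp) (proj₁ εp<1) factor*q+εp≈p
    σ : QueryStrategy D rounds
    σ = record
      -- The strategy is deterministic, so one seed carries all the probability.
      { seeds   = 1
      ; prob    = λ _ → 1#
      ; prob≥0  = λ _ → 0≤1
      ; ∑prob≈1 = R.+-identityʳ 1#
      ; tree    = λ _ → greedy rounds ⊥ ⊥
      }
    -- With an empty past, conditioning leaves `A` as it is.
    start : ∀ A → 𝟙 (good? (⊥ ∪ queried (greedy rounds ⊥ ⊥) (mix ⊥ ⊥ A)) (mix ⊥ ⊥ A)) ≡ 𝟙 (good? (queried (greedy rounds ⊥ ⊥) A) A)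
    start A = ≡.trans (cong (λ A → 𝟙 (good? (⊥ ∪ queried (greedy rounds ⊥ ⊥) A) A)) (mix-⊥ ⊥ A))
      (cong (λ V → 𝟙 (good? V A)) (∪-identityˡ _))
    success : HasApproximationFactor p f σ factor δ
    success = O.trans
      (≤-by (x≤y⇒0≤y-x failure≤δ) (solve 2 (λ δ β → (con (+ 1) :- δ) :+ (δ :- β) := con (+ 1) :- β) R.refl δ _))
      (O.≤-respʳ-≈
        -- The sum over the single seed collapses, which identifies `Pr` with the expectation in
        -- `greedy-succeeds`.
        (R.trans (𝔼-cong (λ A → R.reflexive (start A)))
          (R.sym (R.trans (R.+-identityʳ _) (R.trans (∑-mass≈𝔼 n 1# _) (R.*-identityˡ _)))))
        (greedy-succeeds rounds ⊥ ⊥))
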